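{- Let $\Omega\subseteq\Xi$ be closed under variable substitution. Suppose $\Omega$ is transitive and normal, and $\operatorname{D}_\Delta(\emptyset)<\infty$ for every tuple of variables $\bar x$ and every finite $\Delta\subseteq\Omega\restriction\bar x$. Then for every tuple $\bar a$ and all sets $B$, $C$ (with $\bar x$ a tuple of variables compatible with $\bar a$) the following conditions are equivalent: (1) $\bar a\perp^{\Omega*}_CB$. (2) $\operatorname{D}_\Delta(\bar a/BC)=\operatorname{D}_\Delta(\bar a/C)$ for all finite $\Delta\subseteq\Omega\restriction\bar x$. (3) $B\perp^{\Omega*}_C\bar a$.
   Context: $T$ is a complete consistent first-order theory (possibly many-sorted); we work in a big saturated model of $T$. All sets are small subsets of the big model; $BC$ means $B\cup C$. Tuples may be infinite; a tuple also denotes the set of its entries, and $\bar a\in A$ means that all entries of $\bar a$ lie in $A$. $A\equiv_BA'$ means that some automorphism fixing $B$ pointwise maps the set $A$ onto $A'$. Writing a formula as $\varphi(\bar x)$ means that each of its free variables appears in the (possibly infinite) tuple $\bar x$, dummy variables being allowed. Inconsistency pairs. For a formula $\varphi(\bar x;\bar y)$ whose free variables are partitioned into two blocks, a formula $\psi(\bar y_0,\dots,\bar y_{k-1})$ (also written $\psi(\bar y_{<k})$; no parameters) is a $k$-inconsistency witness for $\varphi(\bar x;\bar y)$ if $\big(\bigwedge_{i<k}\varphi(\bar x;\bar y_i)\big)\wedge\psi(\bar y_{<k})$ is inconsistent. $\Xi$ is the set of all pairs $(\varphi(\bar x;\bar y),\psi(\bar y_{<k}))$, $k<\omega$, such that $\psi$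 is a $k$-inconsistency witness for $\varphi$. For $\Omega\subseteq\Xi$, $\Omega\restriction\bar x$ is the set of pairs $(\varphi,\psi)\in\Omega$ such that $\varphi$ has the form $\varphi(\bar x;\bar y)$, with arbitrary $\bar y$ (i.e. the left-hand block of variables of $\varphi$ is taken from $\bar x$). Dividing. For $(\varphi,\psi)\in\Xi$, a formula $\varphi(\bar x;\bar b)$ $(\varphi,\psi)$-divides over a set $C$ if there is a sequence $(\bar b_i)_{i<\omega}$ such that each $\bar b_i$ realises $\operatorname{tp}(\bar b/C)$ and $\models\psi(\bar b_{i_0},\dots,\bar b_{i_{k-1}})$ for all $i_0<\dots<i_{k-1}<\omega$. A partial type $(\varphi,\psi)$-divides over $C$ if it contains a formula $\varphi(\bar x;\bar b)$ that $(\varphi,\psi)$-divides over $C$. A set $\Omega\subseteq\Xi$ is closed under variable substitution if whenever $(\varphi(\bar x;\bar y),\psi(\bar y_{<k}))\in\Omega$ and $\bar u,\bar v,\bar v_0,\dots,\bar v_{k-1}$ are tuples of variables of appropriate lengths and sorts (possibly with repetitions inside a tuple, but pairwise disjoint from each other), then $(\varphi(\bar u;\bar v),\psi(\bar v_{<k}))\in\Omega$. A partial type $\Omega$-divides over $C$ if it $(\varphi,\psi)$-divides over $C$ for some $(\varphi,\psi)\in\Omega$. Define $A\perp^{\Omega}_CB$ iff there is no $\bar a\in A$ such that $\operatorname{tp}(\bar a/BC)$ $\Omega$-divides over $C$; and $A\perp^{\Omega*}_CB$ iff for all $\hat B\supseteq B$ there is $A'\equiv_{BC}A$ such that $A'\perp^\Omega_C\hat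 B$. For $\Omega\subseteq\Xi$ closed under variable substitution: - $\Omega$ is transitive if: whenever $(\varphi(\bar y;\bar x),\psi(\bar x_{<k}))\in\Omega$, $D\subseteq C$, $C\perp^\Omega_D\bar a$ and $\varphi(\bar y;\bar a)$ $(\varphi,\psi)$-divides over $D$, then $\varphi(\bar y;\bar a)$ $(\varphi,\psi)$-divides over $C$. - $\Omega$ is normal if: whenever $(\varphi(\bar x,\bar z;\bar y),\psi(\bar y_{<k}))\in\Omega$, then also $(\varphi(\bar x;\bar z,\bar y),\psi'(\bar y_{<k},\bar z_{<k}))\in\Omega$, where $\psi'$ is $\psi(\bar y_{<k})\wedge(\bar z_0=\bar z_1=\dots=\bar z_{k-1})$. Local rank. Let $p(\bar x)$ be a partial type over $C$, $I$ a linearly ordered set and $\Delta\subseteq\Xi\restriction\bar x$. A sequence $\xi=((\varphi^i,\psi^i))_{i\in I}\in\Delta^I$ is a $\Delta$-dividing pattern for $p(\bar x)$ if there is a sequence $(\bar b^i)_{i\in I}$ such that $p(\bar x)\cup\{\varphi^i(\bar x;\bar b^i)\mid i\in I\}$ is consistent and each formula $\varphi^i(\bar x;\bar b^i)$ $(\varphi^i,\psi^i)$-divides over $C\cup\bigcup_{j<i}\bar b^j$. (This does not depend on the choice of the set $C$ over which $p$ is defined.) For finite $\Delta\subseteq\Xi\restriction\bar x$, $\operatorname{D}_\Delta(p)\in\omega\cup\{\infty\}$ is $\infty$ if $p$ has $\Delta$-dividing patterns of arbitrary order type, and otherwise the greatest $n<\omega$ such that $p$ has a $\Delta$-dividing pattern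 of length $n$. $\operatorname{D}_\Delta(\bar a/B)$ means $\operatorname{D}_\Delta(\operatorname{tp}(\bar a/B))$, and $\operatorname{D}_\Delta(\emptyset)$ is the rank of the empty partial type in $\bar x$. -}

module Defs where

open import Level using (0ℓ) renaming (suc to lsuc)
open import Data.Empty using (⊥)
import Data.Empty.Polymorphic as Poly
open import Data.Fin as Fin using (Fin; inject₁)
open import Data.List using (List; []; _∷_; foldr; map; concatMap; allFin)
open import Data.List.Membership.Propositional using (_∈_; mapWith∈)
open import Data.List.Relation.Unary.All as All using (All; []; _∷_)
open import Data.Nat as ℕ using (ℕ; zero; suc)
open import Data.Product using (Σ; ∃; Σ-syntax; ∃-syntax; _×_; _,_; proj₁; proj₂)
open import Data.Sum using (_⊎_; inj₁; inj₂; [_,_]; assocʳ)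
open import Function using (_⇔_; Injective)
open import Relation.Binary using (Rel; IsStrictTotalOrder; _Preserves_⟶_)
open import Relation.Binary.PropositionalEquality using (_≡_)
open import Relation.Nullary using (¬_)
open import Relation.Unary using (Pred)

-- "Small" means "in Set": languages, tuples of variables and subsets of the
-- big model are indexed by types in Set, while structures live in Set₁.

data ℕ∞ : Set where
  fin : ℕ → ℕ∞
  ∞   : ℕ∞

record Language : Set₁ where
  field
    Sort   : Set
    FunSym : List Sort → Sort → Set
    RelSym : List Sort → Set

module FirstOrder (L : Language) where
  open Language L public

  -- A (possibly infinite) tuple of distinct variables: x s is the set of those
  -- of sort s.
  Ctx : Set₁
  Ctx = Sort → Set

  infixr 6 _⊕_
  infix  4 _⟶_

  _⟶_ : ∀ {a b} → (Sort → Set a) → (Sort → Set b) → Set _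
  x ⟶ A = ∀ s → x s → A s

  _⊕_ : Ctx → Ctx → Ctx
  (x ⊕ y) s = x s ⊎ y s

  ∅ᶜ : Ctx
  ∅ᶜ _ = ⊥

  ⟨⟩ : ∀ {a} {A : Sort → Set a} → ∅ᶜ ⟶ A
  ⟨⟩ _ ()

  -- The finite tuple of variables with the given list of sorts.
  ⌊_⌋ : List Sort → Ctx
  ⌊ zs ⌋ s = s ∈ zs

  -- y₀,…,y_{k-1}: pairwise disjoint copies of the tuple y.
  copies : ℕ → Ctx → Ctx
  copies k y s = Fin k × y s

  ⟨_,_⟩ : ∀ {a} {A : Sort → Set a} {x y : Ctx} → x ⟶ A → y ⟶ A → x ⊕ y ⟶ A
  ⟨ f , g ⟩ s = [ f s , g s ]

  -- x is the tuple of admissible free variables, Γ lists the sorts of the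
  -- variables bound so far (de Bruijn).
  data Term (x : Ctx) (Γ : List Sort) : Sort → Set where
    var : ∀ {s} → x s → Term x Γ s
    bnd : ∀ {s} → s ∈ Γ → Term x Γ s
    fun : ∀ {Δ s} → FunSym Δ s → All (Term x Γ) Δ → Term x Γ s

  infix  7 _≐_
  infixr 6 _∧̇_
  infixr 5 _⇒̇_

  data Formula (x : Ctx) (Γ : List Sort) : Set where
    ⊥̇    : Formula x Γ
    _≐_  : ∀ {s} → Term x Γ s → Term x Γ s → Formula x Γ
    rel  : ∀ {Δ} → RelSym Δ → All (Term x Γ) Δ → Formula x Γ
    _∧̇_  : Formula x Γ → Formula x Γ → Formula x Γ
    _⇒̇_  : Formula x Γ → Formula x Γ → Formula x Γ
    ∀̇    : ∀ s → Formula x (s ∷ Γ) → Formula x Γ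

  ¬̇_ : ∀ {x Γ} → Formula x Γ → Formula x Γ
  ¬̇ φ = φ ⇒̇ ⊥̇

  ⋀ : ∀ {x Γ} → List (Formula x Γ) → Formula x Γ
  ⋀ = foldr _∧̇_ (⊥̇ ⇒̇ ⊥̇)

  Sentence : Set
  Sentence = Formula ∅ᶜ []

  mutual
    renᵗ : ∀ {x u Γ s} → x ⟶ u → Term x Γ s → Term u Γ s
    renᵗ f (var v)    = var (f _ v)
    renᵗ f (bnd i)    = bnd i
    renᵗ f (fun F ts) = fun F (renᵗˢ f ts)

    renᵗˢ : ∀ {x u Γ Δ} → x ⟶ u → All (Term x Γ) Δ → All (Term u Γ) Δ
    renᵗˢ f []       = []
    renᵗˢ f (t ∷ ts) = renᵗ f t ∷ renᵗˢ f ts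

  -- Substitution of variables for the free variables.
  ren : ∀ {x u Γ} → x ⟶ u → Formula x Γ → Formula u Γ
  ren f ⊥̇          = ⊥̇
  ren f (t ≐ t′)   = renᵗ f t ≐ renᵗ f t′
  ren f (rel R ts) = rel R (renᵗˢ f ts)
  ren f (φ ∧̇ χ)    = ren f φ ∧̇ ren f χ
  ren f (φ ⇒̇ χ)    = ren f φ ⇒̇ ren f χ
  ren f (∀̇ s φ)    = ∀̇ s (ren f φ)

  record Structure : Set₂ where
    field
      Carrier   : Sort → Set₁
      inhabited : ∀ s → Carrier s
      ⟦fun⟧     : ∀ {Δ s} → FunSym Δ s → All Carrier Δ → Carrier s
      ⟦rel⟧     : ∀ {Δ} → RelSym Δ → All Carrier Δ → Set₁

  module _ (M : Structure) where
    open Structure M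

    mutual
      eval : ∀ {x Γ s} → x ⟶ Carrier → All Carrier Γ → Term x Γ s → Carrier s
      eval a ρ (var v)    = a _ v
      eval a ρ (bnd i)    = All.lookup ρ i
      eval a ρ (fun F ts) = ⟦fun⟧ F (evals a ρ ts)

      evals : ∀ {x Γ Δ} → x ⟶ Carrier → All Carrier Γ → All (Term x Γ) Δ → All Carrier Δ
      evals a ρ []       = []
      evals a ρ (t ∷ ts) = eval a ρ t ∷ evals a ρ ts

    Sat : ∀ {x Γ} → x ⟶ Carrier → All Carrier Γ → Formula x Γ → Set₁
    Sat a ρ ⊥̇          = Poly.⊥
    Sat a ρ (t ≐ t′)   = eval a ρ t ≡ eval a ρ t′
    Sat a ρ (rel R ts) = ⟦rel⟧ R (evals a ρ ts)
    Sat a ρ (φ ∧̇ χ)    = Sat a ρ φ × Sat a ρ χ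
    Sat a ρ (φ ⇒̇ χ)    = Sat a ρ φ → Sat a ρ χ
    Sat a ρ (∀̇ s φ)    = (m : Carrier s) → Sat a (m ∷ ρ) φ

    infix 4 _⊨_

    _⊨_ : ∀ {x} → Formula x [] → x ⟶ Carrier → Set₁
    φ ⊨ a = Sat a [] φ

    record Automorphism : Set₁ where
      field
        to      : Carrier ⟶ Carrier
        from    : Carrier ⟶ Carrier
        to∘from : ∀ s m → to s (from s m) ≡ m
        from∘to : ∀ s m → from s (to s m) ≡ m
        pres-fun : ∀ {Δ s} (F : FunSym Δ s) ms →
                   to s (⟦fun⟧ F ms) ≡ ⟦fun⟧ F (All.map (λ {t} → to t) ms)
        pres-rel : ∀ {Δ} (R : RelSym Δ) ms →
                   ⟦rel⟧ R ms ⇔ ⟦rel⟧ R (All.map (λ {t} → to t) ms)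

    -- A small subset, presented by an enumeration (possibly with repetitions).
    record SmallSet : Set₁ where
      constructor ⟪_⟫
      field
        {Ix} : Ctx
        elt  : Ix ⟶ Carrier

  module Small (M : Structure) where
    open Structure M
    open SmallSet

    infix 4 _∈ˢ_ _⊆ˢ_
    infixr 6 _∪ˢ_

    _∈ˢ_ : ∀ {s} → Carrier s → SmallSet M → Set₁
    _∈ˢ_ {s} m A = Σ[ i ∈ Ix A s ] elt A s i ≡ m

    _⊆ˢ_ : SmallSet M → SmallSet M → Set₁
    A ⊆ˢ B = ∀ {s} (m : Carrier s) → m ∈ˢ A → m ∈ˢ B

    ∅ˢ : SmallSet M
    ∅ˢ = ⟪ ⟨⟩ ⟫

    _∪ˢ_ : SmallSet M → SmallSet M → SmallSet M
    A ∪ˢ B = ⟪ ⟨ elt A , elt B ⟩ ⟫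

    ⋃ˢ : (J : Set) → (J → SmallSet M) → SmallSet M
    ⋃ˢ J A = ⟪_⟫ {Ix = λ s → Σ[ j ∈ J ] Ix (A j) s} λ s (j , i) → elt (A j) s i

    -- A ≡[ B ] A′: some automorphism fixing B pointwise maps A onto A′.
    _≡[_]_ : SmallSet M → SmallSet M → SmallSet M → Set₁
    A ≡[ B ] A′ = Σ[ σ ∈ Automorphism M ] let open Automorphism σ in
        (∀ {s} (m : Carrier s) → m ∈ˢ B → to s m ≡ m)
      × (∀ {s} (m : Carrier s) → m ∈ˢ A → to s m ∈ˢ A′)
      × (∀ {s} (m : Carrier s) → m ∈ˢ A′ → ∃[ m₀ ] (m₀ ∈ˢ A × to s m₀ ≡ m))

    -- Partial types p(x) over C.  A formula over C is a formula whose parameters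
    -- are named by the indices of C.
    PType : Ctx → SmallSet M → Set₂
    PType x C = Pred (Formula (x ⊕ Ix C) []) (lsuc 0ℓ)

    ∅ᵗ : ∀ {x} (C : SmallSet M) → PType x C
    ∅ᵗ C _ = Poly.⊥

    tp : ∀ {x} → x ⟶ Carrier → (C : SmallSet M) → PType x C
    tp a C φ = _⊨_ M φ ⟨ a , elt C ⟩

    Realises : ∀ {x} (C : SmallSet M) → x ⟶ Carrier → PType x C → Set₁
    Realises C a p = ∀ φ → p φ → tp a C φ

    -- Consistency with the elementary diagram of M, i.e. finite satisfiability.
    Consistent : ∀ {x} (C : SmallSet M) → PType x C → Set₁
    Consistent {x} C p =
      ∀ (φs : List (Formula (x ⊕ Ix C) [])) → All p φs →
      Σ[ a ∈ (x ⟶ Carrier) ] All (tp a C) φs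

  Theory : Set₁
  Theory = Pred Sentence 0ℓ

  IsModel : Theory → Structure → Set₁
  IsModel T M = ∀ θ → T θ → _⊨_ M θ ⟨⟩

  infix 4 _⊩_

  _⊩_ : Theory → Sentence → Set₂
  T ⊩ θ = ∀ M → IsModel T M → _⊨_ M θ ⟨⟩

  ConsistentTheory : Theory → Set₂
  ConsistentTheory T = Σ[ M ∈ Structure ] IsModel T M

  CompleteTheory : Theory → Set₂
  CompleteTheory T = ∀ θ → (T ⊩ θ) ⊎ (T ⊩ ¬̇ θ)

  -- The big model: saturated and strongly homogeneous with respect to all
  -- small sets of parameters and small tuples.
  record BigModel (T : Theory) : Set₂ where
    field
      𝕄 : Structure
    open Structure 𝕄 public
    open Small 𝕄
    field
      isModel     : IsModel T 𝕄
      saturated   : ∀ {x C} (p : PType x C) → Consistent C p →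
                    Σ[ a ∈ (x ⟶ Carrier) ] Realises C a p
      homogeneous : ∀ {x} (a b : x ⟶ Carrier) → Realises ∅ˢ b (tp a ∅ˢ) →
                    Σ[ σ ∈ Automorphism 𝕄 ]
                      (∀ s v → Automorphism.to σ s (a s v) ≡ b s v)

  -- A pair (φ(x;y), ψ(y₀,…,y_{k-1})).
  record FPair (x y : Ctx) : Set where
    constructor pair
    field
      {k} : ℕ
      φ   : Formula (x ⊕ y) []
      ψ   : Formula (copies k y) []

  substitute : ∀ {x y u v : Ctx} → x ⟶ u → y ⟶ v → FPair x y → FPair u v
  substitute f g (pair φ ψ) = pair
    (ren ⟨ (λ s w → inj₁ (f s w)) , (λ s w → inj₂ (g s w)) ⟩ φ)
    (ren (λ s (i , w) → i , g s w) ψ)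

  InjectiveRen : ∀ {x u : Ctx} → x ⟶ u → Set
  InjectiveRen f = ∀ s → Injective _≡_ _≡_ (f s)

  consecutive : ∀ k → List (Fin k × Fin k)
  consecutive zero    = []
  consecutive (suc n) = map (λ i → inject₁ i , Fin.suc i) (allFin n)

  -- z₀ = z₁ = … = z_{k-1}, as a formula in the variables (zᵢ, yᵢ)_{i<k}
  allEqual : ∀ k (zs : List Sort) (y : Ctx) → Formula (copies k (⌊ zs ⌋ ⊕ y)) []
  allEqual k zs y = ⋀ (concatMap
    (λ (i , j) → mapWith∈ zs λ z → var (i , inj₁ z) ≐ var (j , inj₁ z))
    (consecutive k))

  -- (φ(x,z;y), ψ) ↦ (φ(x;z,y), ψ ∧ z₀ = … = z_{k-1}).  The tuple z is finite,
  -- as otherwise the second component would not be a formula.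
  shift : ∀ {x y} (zs : List Sort) → FPair (x ⊕ ⌊ zs ⌋) y → FPair x (⌊ zs ⌋ ⊕ y)
  shift {y = y} zs (pair φ ψ) = pair
    (ren (λ _ → assocʳ) φ)
    (ren (λ s (i , w) → i , inj₂ w) ψ ∧̇ allEqual _ zs y)

  module Dividing {T : Theory} (𝔐 : BigModel T) where
    open BigModel 𝔐
    open Small 𝕄
    open SmallSet
    open FPair

    -- Membership in Ξ; "inconsistent" means not satisfiable in the big model.
    IsInconsistencyPair : ∀ {x y} → FPair x y → Set₁
    IsInconsistencyPair {x} {y} π =
      ¬ (Σ[ a ∈ (x ⊕ copies (k π) y ⟶ Carrier) ] _⊨_ 𝕄 θ a)
      where
      θ : Formula (x ⊕ copies (k π) y) []
      θ = ⋀ (map (λ i → ren ⟨ (λ _ → inj₁) , (λ _ w → inj₂ (i , w)) ⟩ (φ π))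
                 (allFin (k π)))
        ∧̇ ren (λ _ → inj₂) (ψ π)

    -- Subsets Ω of Ξ.  A pair of formulas does not determine the ambient tuples
    -- x and y, which may contain dummy variables; hence membership must be
    -- insensitive to adding or removing dummy variables.
    record ΞSubset : Set₂ where
      field
        _∋_    : ∀ {x y} → FPair x y → Set₁
        ⊆Ξ     : ∀ {x y} (π : FPair x y) → _∋_ π → IsInconsistencyPair π
        dummies : ∀ {x y u v : Ctx} (ι : x ⟶ u) (κ : y ⟶ v) →
                  InjectiveRen ι → InjectiveRen κ →
                  (π : FPair x y) → _∋_ π ⇔ _∋_ (substitute ι κ π)

    infix 4 _∋_
    _∋_ : ΞSubset → ∀ {x y} → FPair x y → Set₁
    _∋_ = ΞSubset._∋_

    -- φ(x;b) (φ,ψ)-divides over C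
    Divides : ∀ {x y} → FPair x y → y ⟶ Carrier → SmallSet 𝕄 → Set₁
    Divides {y = y} π b C =
      Σ[ b′ ∈ (ℕ → (y ⟶ Carrier)) ]
          (∀ i → Realises C (b′ i) (tp b C))
        × (∀ (ι : Fin (k π) → ℕ) → ι Preserves Fin._<_ ⟶ ℕ._<_ →
             _⊨_ 𝕄 (ψ π) λ s (j , w) → b′ (ι j) s w)

    -- For p(x) over B: some φ(x;b) in p with b ∈ B (φ,ψ)-divides over C.
    TypeDivides : ∀ {x y} → FPair x y → (B : SmallSet 𝕄) → PType x B → SmallSet 𝕄 → Set₁
    TypeDivides {x} {y} π B p C =
      Σ[ β ∈ (y ⟶ Ix B) ]
          p (ren ⟨ (λ _ → inj₁) , (λ s w → inj₂ (β s w)) ⟩ (φ π))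
        × Divides π (λ s w → elt B s (β s w)) C

    ΩDivides : ∀ {x} → ΞSubset → (B : SmallSet 𝕄) → PType x B → SmallSet 𝕄 → Set₁
    ΩDivides {x} Ω B p C =
      Σ[ y ∈ Ctx ] Σ[ π ∈ FPair x y ] Ω ∋ π × TypeDivides π B p C

    -- A ⊥^Ω_C B and A ⊥^{Ω*}_C B; the arguments come in the order A C B.
    infix 4 _⊥⟨_⟩[_]_ _⊥*⟨_⟩[_]_

    _⊥⟨_⟩[_]_ : SmallSet 𝕄 → ΞSubset → SmallSet 𝕄 → SmallSet 𝕄 → Set₁
    A ⊥⟨ Ω ⟩[ C ] B =
      ¬ (Σ[ x ∈ Ctx ] Σ[ α ∈ (x ⟶ Ix A) ]
           ΩDivides Ω (B ∪ˢ C) (tp (λ s v → elt A s (α s v)) (B ∪ˢ C)) C)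

    _⊥*⟨_⟩[_]_ : SmallSet 𝕄 → ΞSubset → SmallSet 𝕄 → SmallSet 𝕄 → Set₁
    A ⊥*⟨ Ω ⟩[ C ] B =
      ∀ B̂ → B ⊆ˢ B̂ → ∃[ A′ ] (A ≡[ B ∪ˢ C ] A′ × A′ ⊥⟨ Ω ⟩[ C ] B̂)

    ClosedUnderSubstitution : ΞSubset → Set₁
    ClosedUnderSubstitution Ω =
      ∀ {x y u v : Ctx} (π : FPair x y) → Ω ∋ π →
      (f : x ⟶ u) (g : y ⟶ v) → Ω ∋ substitute f g π

    Transitive : ΞSubset → Set₁
    Transitive Ω =
      ∀ {y x} (π : FPair y x) → Ω ∋ π →
      ∀ (D C : SmallSet 𝕄) (a : x ⟶ Carrier) → D ⊆ˢ C →
      C ⊥⟨ Ω ⟩[ D ] ⟪ a ⟫ → Divides π a D → Divides π a C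

    Normal : ΞSubset → Set₁
    Normal Ω =
      ∀ {x y} (zs : List Sort) (π : FPair (x ⊕ ⌊ zs ⌋) y) → Ω ∋ π → Ω ∋ shift zs π

    FPairs : Ctx → Set₁
    FPairs x = List (Σ[ y ∈ Ctx ] FPair x y)

    -- Δ ⊆ Ω↾x
    _⊆_↾ : ∀ {x} → FPairs x → ΞSubset → Set₁
    Δ ⊆ Ω ↾ = All (λ (_ , π) → Ω ∋ π) Δ

    module _ {x : Ctx} {I : Set} (ξ : I → Σ[ y ∈ Ctx ] FPair x y)
             (b : ∀ i → proj₁ (ξ i) ⟶ Carrier) (C : SmallSet 𝕄) where

      -- p(x) ∪ { φⁱ(x;bⁱ) | i ∈ I }
      data Extend (p : PType x C) : PType x (C ∪ˢ ⋃ˢ I (λ i → ⟪ b i ⟫)) where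
        old : ∀ {χ} → p χ → Extend p
          (ren ⟨ (λ _ → inj₁) , (λ _ c → inj₂ (inj₁ c)) ⟩ χ)
        new : ∀ i → Extend p
          (ren ⟨ (λ _ → inj₁) , (λ _ w → inj₂ (inj₂ (i , w))) ⟩ (φ (proj₂ (ξ i))))

      -- C ∪ ⋃_{j<i} bʲ
      below : Rel I 0ℓ → I → SmallSet 𝕄
      below _<_ i = C ∪ˢ ⋃ˢ (Σ[ j ∈ I ] j < i) (λ (j , _) → ⟪ b j ⟫)

    IsDividingPattern : ∀ {x} → FPairs x → (C : SmallSet 𝕄) → PType x C →
                        {I : Set} → Rel I 0ℓ → (I → Σ[ y ∈ Ctx ] FPair x y) → Set₁
    IsDividingPattern Δ C p {I} _<_ ξ =
        (∀ i → ξ i ∈ Δ)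
      × (Σ[ b ∈ (∀ i → proj₁ (ξ i) ⟶ Carrier) ]
            Consistent (C ∪ˢ ⋃ˢ I (λ i → ⟪ b i ⟫)) (Extend ξ b C p)
          × (∀ i → Divides (proj₂ (ξ i)) (b i) (below ξ b C _<_ i)))

    HasPattern : ∀ {x} → FPairs x → (C : SmallSet 𝕄) → PType x C →
                 {I : Set} → Rel I 0ℓ → Set₁
    HasPattern Δ C p _<_ = ∃[ ξ ] IsDividingPattern Δ C p _<_ ξ

    HasAllPatterns : ∀ {x} → FPairs x → (C : SmallSet 𝕄) → PType x C → Set₁
    HasAllPatterns Δ C p =
      ∀ {I : Set} (_<_ : Rel I 0ℓ) → IsStrictTotalOrder _≡_ _<_ → HasPattern Δ C p _<_

    -- D_Δ(p) = v, for p over C and v ∈ ω ∪ {∞}.  The rank is given by its graph: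
    -- at most one v qualifies, and that one exists is a consequence of
    -- compactness (for consistent p).
    D_⟨_,_⟩≔_ : ∀ {x} → FPairs x → (C : SmallSet 𝕄) → PType x C → ℕ∞ → Set₁
    D Δ ⟨ C , p ⟩≔ ∞     = HasAllPatterns Δ C p
    D Δ ⟨ C , p ⟩≔ fin n =
        ¬ HasAllPatterns Δ C p
      × HasPattern Δ C p {Fin n} Fin._<_
      × (∀ m → HasPattern Δ C p {Fin m} Fin._<_ → m ℕ.≤ n)

    D∅<∞ : ∀ {x} → FPairs x → Set₁
    D∅<∞ Δ = ∃[ n ] (D Δ ⟨ ∅ˢ , ∅ᵗ ∅ˢ ⟩≔ fin n)

    SameD : ∀ {x} → FPairs x → x ⟶ Carrier → SmallSet 𝕄 → SmallSet 𝕄 → Set₁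
    SameD Δ a B C = ∃[ v ] ((D Δ ⟨ B , tp a B ⟩≔ v) × (D Δ ⟨ C , tp a C ⟩≔ v))

{-# OPTIONS --safe #-}
module Submission where

-- Call a sequence of formulas φⁱ(x;bⁱ) satisfied by a, each dividing over the base
-- together with the previous parameters, a pattern of a over the base.
--
-- (3) ⇒ (2): if B ⊥* a over C, move B by an automorphism over aC so that B ⊥ a b̄ for the
-- parameters b̄ of a pattern of a over C.  By normality the left-hand side of ⊥ absorbs
-- the base, so transitivity, applied step by step, shows that the same formulas form a
-- pattern over BC.
--
-- (2) ⇒ (1): enlarge B to B̂.  By pigeonhole and saturation a pattern of a over BC becomes,
-- with new parameters, a pattern over B̂C of a conjugate a′ of a over BC.  Take it of
-- maximal length: a′ cannot satisfy a formula over B̂C dividing over C, since putting that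
-- formula in front would give a longer pattern over C.  This yields the finite
-- satisfiability of the type sought.
--
-- (1) ⇒ (3) is (3) ⇒ (1) with the two sides exchanged, sets being enumerated by tuples.

open import Defs
open import Axiom.ExcludedMiddle using (ExcludedMiddle)
open import Data.Empty using (⊥-elim)
open import Data.Fin as Fin using (Fin)
import Data.Fin.Properties as Fin
open import Data.List using (List; []; _∷_; [_]; _++_)
open import Data.List.Membership.Propositional using (_∈_; mapWith∈)
open import Data.List.Relation.Unary.All as All using (All; []; _∷_)
import Data.List.Relation.Unary.All.Properties as All
open import Data.List.Relation.Unary.Any using (here; there)
open import Data.Nat as ℕ using (ℕ; zero; suc; s≤s; s<s; z<s)
import Data.Nat.Properties as ℕ
open import Data.Product using (Σ; Σ-syntax; ∃-syntax; _×_; _,_; proj₁; proj₂; -,_)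
open import Data.Product.Function.NonDependent.Propositional using (_×-⇔_)
open import Data.Sum as Sum using (inj₁; inj₂)
open import Data.Sum.Properties using (inj₂-injective)
open import Function using (_⇔_; mk⇔; Equivalence; id; _∘_)
open import Function.Properties.Equivalence using ()
  renaming (refl to ⇔-refl; sym to ⇔-sym; trans to ⇔-trans)
open import Function.Related.Propositional using (≡⇒)
open import Function.Related.TypeIsomorphisms using (→-cong-⇔)
open import Level using (Lift; lift)
open import Relation.Binary using (_Preserves_⟶_)
open import Relation.Binary.PropositionalEquality
  using (_≡_; refl; sym; trans; cong; cong₂; subst)
open import Relation.Nullary using (¬_; yes; no; decidable-stable)

open Equivalence using (to; from)

-- Lists and sequences of natural numbers.

mapWith∈⁺ : ∀ {a b p} {A : Set a} {B : Set b} {P : B → Set p} (xs : List A)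
  {f : ∀ {x} → x ∈ xs → B} → (∀ {x} (x∈xs : x ∈ xs) → P (f x∈xs)) → All P (mapWith∈ xs f)
mapWith∈⁺ []       pf = []
mapWith∈⁺ (x ∷ xs) pf = pf (here refl) ∷ mapWith∈⁺ xs (λ x∈xs → pf (there x∈xs))

StrictlyIncreasing : (ℕ → ℕ) → Set
StrictlyIncreasing g = g Preserves ℕ._<_ ⟶ ℕ._<_

increasing : (g : ℕ → ℕ) → (∀ n → g n ℕ.< g (suc n)) → StrictlyIncreasing g
increasing g step {m} m<n = go (ℕ.≤⇒≤′ m<n)
  where
  go : ∀ {n} → suc m ℕ.≤′ n → g m ℕ.< g n
  go (ℕ.≤′-reflexive refl) = step m
  go (ℕ.≤′-step p)         = ℕ.<-trans (go p) (step _)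

module Classical (em : ∀ {ℓ} → ExcludedMiddle ℓ) where

  -- If `P` fails from some index on, that tail works, the implication being vacuous. Otherwise `P`
  -- holds at arbitrarily large indices, and these are enumerated.
  homogeneous-subsequence : ∀ {ℓ} (P : ℕ → Set ℓ) →
    Σ[ g ∈ (ℕ → ℕ) ] (StrictlyIncreasing g × (∀ i j → P (g i) → P (g j)))
  homogeneous-subsequence P with em {P = Σ[ n ∈ ℕ ] ∀ m → n ℕ.≤ m → ¬ P m}
  ... | yes (n , ¬P) = (n ℕ.+_) , ℕ.+-monoʳ-< n ,
        λ i _ p → ⊥-elim (¬P (n ℕ.+ i) (ℕ.m≤m+n n i) p)
  ... | no unbounded = g , increasing g (λ n → next-≥ (suc (g n))) , λ _ j _ → P-g j
    where
    -- Excluded middle for a Σ-type yields a witness, hence serves as choice.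
    next : ∀ n → Σ[ m ∈ ℕ ] n ℕ.≤ m × P m
    next n = decidable-stable em λ none →
      unbounded (n , λ m n≤m p → none (m , n≤m , p))
    next-≥ : ∀ n → n ℕ.≤ proj₁ (next n)
    next-≥ n = proj₁ (proj₂ (next n))
    g : ℕ → ℕ
    g zero    = proj₁ (next zero)
    g (suc n) = proj₁ (next (suc (g n)))
    P-g : ∀ n → P (g n)
    P-g zero    = proj₂ (proj₂ (next zero))
    P-g (suc n) = proj₂ (proj₂ (next (suc (g n))))

  maximum : ∀ {ℓ} (P : ℕ → Set ℓ) N → P 0 → (∀ m → P m → m ℕ.≤ N) →
            Σ[ n ∈ ℕ ] (P n × (∀ m → P m → m ℕ.≤ n))
  maximum P zero    p₀ bound = 0 , p₀ , bound
  maximum P (suc N) p₀ bound with em {P = P (suc N)}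
  ... | yes p = suc N , p , bound
  ... | no ¬p = maximum P N p₀ λ m p →
        ℕ.≤-pred (ℕ.≤∧≢⇒< (bound m p) λ { refl → ¬p p })

-- Satisfaction under renamings and automorphisms.

module Syntax (L : Language) where
  open FirstOrder L

  module Semantics (M : Structure) where
    open Structure M

    mutual
      eval-ren : ∀ {x u Γ s} (f : x ⟶ u) {a : u ⟶ Carrier} {a′ : x ⟶ Carrier}
        {ρ : All Carrier Γ} → (∀ s v → a s (f s v) ≡ a′ s v) →
        (t : Term x Γ s) → eval M a ρ (renᵗ f t) ≡ eval M a′ ρ t
      eval-ren f eq (var v)    = eq _ v
      eval-ren f eq (bnd i)    = refl
      eval-ren f eq (fun F ts) = cong (⟦fun⟧ F) (evals-ren f eq ts)

      evals-ren : ∀ {x u Γ Δ} (f : x ⟶ u) {a : u ⟶ Carrier} {a′ : x ⟶ Carrier}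
        {ρ : All Carrier Γ} → (∀ s v → a s (f s v) ≡ a′ s v) →
        (ts : All (Term x Γ) Δ) → evals M a ρ (renᵗˢ f ts) ≡ evals M a′ ρ ts
      evals-ren f eq []       = refl
      evals-ren f eq (t ∷ ts) = cong₂ _∷_ (eval-ren f eq t) (evals-ren f eq ts)

    Sat-ren : ∀ {x u Γ} (f : x ⟶ u) {a : u ⟶ Carrier} {a′ : x ⟶ Carrier}
      {ρ : All Carrier Γ} → (∀ s v → a s (f s v) ≡ a′ s v) →
      (φ : Formula x Γ) → Sat M a ρ (ren f φ) ⇔ Sat M a′ ρ φ
    Sat-ren f eq ⊥̇          = ⇔-refl
    Sat-ren f eq (t ≐ t′)   =
      ≡⇒ (cong₂ _≡_ (eval-ren f eq t) (eval-ren f eq t′))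
    Sat-ren f eq (rel R ts) = ≡⇒ (cong (⟦rel⟧ R) (evals-ren f eq ts))
    Sat-ren f eq (φ ∧̇ χ)    = Sat-ren f eq φ ×-⇔ Sat-ren f eq χ
    Sat-ren f eq (φ ⇒̇ χ)    = →-cong-⇔ (Sat-ren f eq φ) (Sat-ren f eq χ)
    Sat-ren f eq (∀̇ s φ)    = mk⇔ (λ h m → to (Sat-ren f eq φ) (h m))
                                   (λ h m → from (Sat-ren f eq φ) (h m))

    module _ (σ : Automorphism M) where
      open Automorphism σ using (to∘from; from∘to; pres-fun; pres-rel)
        renaming (to to σ→; from to σ←)

      private
        image : ∀ {Γ} → All Carrier Γ → All Carrier Γ
        image = All.map (λ {s} → σ→ s)

      mutual
        eval-aut : ∀ {x Γ s} {a : x ⟶ Carrier} {ρ : All Carrier Γ} (t : Term x Γ s) →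
          eval M (λ s v → σ→ s (a s v)) (image ρ) t ≡ σ→ s (eval M a ρ t)
        eval-aut (var v)            = refl
        eval-aut {ρ = ρ} (bnd i)    = All.lookup-map ρ i
        eval-aut (fun F ts)         =
          trans (cong (⟦fun⟧ F) (evals-aut ts)) (sym (pres-fun F _))

        evals-aut : ∀ {x Γ Δ} {a : x ⟶ Carrier} {ρ : All Carrier Γ}
          (ts : All (Term x Γ) Δ) →
          evals M (λ s v → σ→ s (a s v)) (image ρ) ts ≡ image (evals M a ρ ts)
        evals-aut []       = refl
        evals-aut (t ∷ ts) = cong₂ _∷_ (eval-aut t) (evals-aut ts)

      σ→-injective : ∀ {s m m′} → σ→ s m ≡ σ→ s m′ → m ≡ m′
      σ→-injective eq = trans (sym (from∘to _ _)) (trans (cong (σ← _) eq) (from∘to _ _))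

      Sat-aut : ∀ {x Γ} {a : x ⟶ Carrier} {ρ : All Carrier Γ} (φ : Formula x Γ) →
        Sat M a ρ φ ⇔ Sat M (λ s v → σ→ s (a s v)) (image ρ) φ
      Sat-aut ⊥̇          = ⇔-refl
      Sat-aut (t ≐ t′)   =
        ⇔-trans (mk⇔ (cong (σ→ _)) σ→-injective)
          (≡⇒ (sym (cong₂ _≡_ (eval-aut t) (eval-aut t′))))
      Sat-aut (rel R ts) =
        ⇔-trans (pres-rel R _) (≡⇒ (sym (cong (⟦rel⟧ R) (evals-aut ts))))
      Sat-aut (φ ∧̇ χ)    = Sat-aut φ ×-⇔ Sat-aut χ
      Sat-aut (φ ⇒̇ χ)    = →-cong-⇔ (Sat-aut φ) (Sat-aut χ)
      Sat-aut {a = a} {ρ} (∀̇ s φ) = mk⇔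
        (λ h m → subst (λ n → Sat M _ (n ∷ image ρ) φ) (to∘from s m)
                   (to (Sat-aut φ) (h (σ← s m))))
        (λ h m → from (Sat-aut φ) (h (σ→ s m)))

      Sat-transport : ∀ {x u} (f : x ⟶ u) {a : x ⟶ Carrier} {b : u ⟶ Carrier} →
        (∀ s v → b s (f s v) ≡ σ→ s (a s v)) →
        (φ : Formula x []) → Sat M a [] φ ⇔ Sat M b [] (ren f φ)
      Sat-transport f eq φ = ⇔-trans (Sat-aut φ) (⇔-sym (Sat-ren f eq φ))

      Sat-conjugate : ∀ {x} {a b : x ⟶ Carrier} → (∀ s v → b s v ≡ σ→ s (a s v)) →
        (φ : Formula x []) → Sat M a [] φ ⇔ Sat M b [] φ
      Sat-conjugate eq φ =
        ⇔-trans (Sat-transport (λ _ → id) eq φ) (Sat-ren _ (λ _ _ → refl) φ)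

    Sat-⋀ : ∀ {x} {a : x ⟶ Carrier} {φs : List (Formula x [])} →
      All (Sat M a []) φs → Sat M a [] (⋀ φs)
    Sat-⋀ []       = λ z → z
    Sat-⋀ (p ∷ ps) = p , Sat-⋀ ps

    identity : Automorphism M
    identity = record
      { to = λ _ → id ; from = λ _ → id
      ; to∘from = λ _ _ → refl ; from∘to = λ _ _ → refl
      ; pres-fun = λ F ms → cong (⟦fun⟧ F) (sym (All.map-id ms))
      ; pres-rel = λ R ms → ≡⇒ (cong (⟦rel⟧ R) (sym (All.map-id ms)))
      }

  -- Free variables and the reversal of a renaming.

  mutual
    freeᵗ : ∀ {x Γ s} → Term x Γ s → List (Σ Sort x)
    freeᵗ (var v)    = [ -, v ]
    freeᵗ (bnd i)    = []
    freeᵗ (fun F ts) = freeᵗˢ ts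

    freeᵗˢ : ∀ {x Γ Δ} → All (Term x Γ) Δ → List (Σ Sort x)
    freeᵗˢ []       = []
    freeᵗˢ (t ∷ ts) = freeᵗ t ++ freeᵗˢ ts

  free : ∀ {x Γ} → Formula x Γ → List (Σ Sort x)
  free ⊥̇          = []
  free (t ≐ t′)   = freeᵗ t ++ freeᵗ t′
  free (rel R ts) = freeᵗˢ ts
  free (φ ∧̇ χ)    = free φ ++ free χ
  free (φ ⇒̇ χ)    = free φ ++ free χ
  free (∀̇ s φ)    = free φ

  module _ {x u : Ctx} (f : x ⟶ u) where

    InImage : Σ Sort u → Set
    InImage (s , v) = Σ[ w ∈ x s ] f s w ≡ v

    mutual
      unrenᵗ : ∀ {Γ s} (t : Term u Γ s) → All InImage (freeᵗ t) →
        Σ[ t₀ ∈ Term x Γ s ] renᵗ f t₀ ≡ t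
      unrenᵗ (var v)    ((w , refl) ∷ []) = var w , refl
      unrenᵗ (bnd i)    _                 = bnd i , refl
      unrenᵗ (fun F ts) im with unrenᵗˢ ts im
      ... | ts₀ , refl = fun F ts₀ , refl

      unrenᵗˢ : ∀ {Γ Δ} (ts : All (Term u Γ) Δ) → All InImage (freeᵗˢ ts) →
        Σ[ ts₀ ∈ All (Term x Γ) Δ ] renᵗˢ f ts₀ ≡ ts
      unrenᵗˢ []       _  = [] , refl
      unrenᵗˢ (t ∷ ts) im with unrenᵗ t (All.++⁻ˡ _ im) | unrenᵗˢ ts (All.++⁻ʳ (freeᵗ t) im)
      ... | t₀ , refl | ts₀ , refl = t₀ ∷ ts₀ , refl

    -- Lets a formula in an infinite tuple be cut down to the finitely many variables that occur in
    -- it. Quantifiers cause no trouble, since renamings leave the de Bruijn variables alone.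
    unren : ∀ {Γ} (φ : Formula u Γ) → All InImage (free φ) →
      Σ[ φ₀ ∈ Formula x Γ ] ren f φ₀ ≡ φ
    unren ⊥̇ _ = ⊥̇ , refl
    unren (t ≐ t′) im with unrenᵗ t (All.++⁻ˡ _ im) | unrenᵗ t′ (All.++⁻ʳ (freeᵗ t) im)
    ... | t₀ , refl | t₀′ , refl = t₀ ≐ t₀′ , refl
    unren (rel R ts) im with unrenᵗˢ ts im
    ... | ts₀ , refl = rel R ts₀ , refl
    unren (φ ∧̇ χ) im with unren φ (All.++⁻ˡ _ im) | unren χ (All.++⁻ʳ (free φ) im)
    ... | φ₀ , refl | χ₀ , refl = φ₀ ∧̇ χ₀ , refl
    unren (φ ⇒̇ χ) im with unren φ (All.++⁻ˡ _ im) | unren χ (All.++⁻ʳ (free φ) im)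
    ... | φ₀ , refl | χ₀ , refl = φ₀ ⇒̇ χ₀ , refl
    unren (∀̇ s φ) im with unren φ im
    ... | φ₀ , refl = ∀̇ s φ₀ , refl

-- Small sets, conjugation and dividing in the big model.

module InBigModel (em : ∀ {ℓ} → ExcludedMiddle ℓ) (L : Language)
  {T : FirstOrder.Theory L} (𝔐 : FirstOrder.BigModel L T) where
  open FirstOrder L
  open Syntax L
  open Classical em
  open BigModel 𝔐
  open Small 𝕄
  open SmallSet
  open Dividing 𝔐
  open FPair
  open Semantics 𝕄

  infix 4 _∈ᵗ_

  _∈ᵗ_ : ∀ {x : Ctx} → x ⟶ Carrier → SmallSet 𝕄 → Set₁
  a ∈ᵗ A = ∀ s v → a s v ∈ˢ A

  ∪ˢ-monoˡ : ∀ {A A′} B → A ⊆ˢ A′ → (A ∪ˢ B) ⊆ˢ (A′ ∪ˢ B)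
  ∪ˢ-monoˡ B A⊆A′ m (inj₁ i , eq) with A⊆A′ m (i , eq)
  ... | j , eq′ = inj₁ j , eq′
  ∪ˢ-monoˡ B A⊆A′ m (inj₂ i , eq) = inj₂ i , eq

  ∪ˢ-⊆ : ∀ {A B D} → A ⊆ˢ D → B ⊆ˢ D → (A ∪ˢ B) ⊆ˢ D
  ∪ˢ-⊆ A⊆D B⊆D m (inj₁ i , eq) = A⊆D m (i , eq)
  ∪ˢ-⊆ A⊆D B⊆D m (inj₂ i , eq) = B⊆D m (i , eq)

  ⊆-∪ˡ : ∀ A B → A ⊆ˢ (A ∪ˢ B)
  ⊆-∪ˡ A B m (i , eq) = inj₁ i , eq

  ⊆-∪ʳ : ∀ A B → B ⊆ˢ (A ∪ˢ B)
  ⊆-∪ʳ A B m (i , eq) = inj₂ i , eq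

  Moves : Automorphism 𝕄 → ∀ {x : Ctx} → x ⟶ Carrier → x ⟶ Carrier → Set₁
  Moves σ a b = ∀ s v → Automorphism.to σ s (a s v) ≡ b s v

  -- For the identity this is inclusion. Hence monotonicity in the base and transport along an
  -- automorphism are instances of the same pullback lemmas.
  MapsInto : Automorphism 𝕄 → SmallSet 𝕄 → SmallSet 𝕄 → Set₁
  MapsInto σ C D = (λ s i → Automorphism.to σ s (elt C s i)) ∈ᵗ D

  ⊆ˢ⇒MapsInto : ∀ {C D} → C ⊆ˢ D → MapsInto identity C D
  ⊆ˢ⇒MapsInto C⊆D s i = C⊆D _ (i , refl)

  Fixes : Automorphism 𝕄 → SmallSet 𝕄 → Set₁
  Fixes σ C = Moves σ (elt C) (elt C)

  MapsInto-∪ : ∀ σ {C C′ D D′} → MapsInto σ C D → MapsInto σ C′ D′ →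
               MapsInto σ (C ∪ˢ C′) (D ∪ˢ D′)
  MapsInto-∪ σ f g s (inj₁ i) with f s i
  ... | j , eq = inj₁ j , eq
  MapsInto-∪ σ f g s (inj₂ i) with g s i
  ... | j , eq = inj₂ j , eq

  Fixes⇒MapsInto : ∀ σ {C} → Fixes σ C → MapsInto σ C C
  Fixes⇒MapsInto σ fix s i = i , sym (fix s i)

  Moves⇒MapsInto : ∀ σ {x} {a b : x ⟶ Carrier} → Moves σ a b → MapsInto σ ⟪ a ⟫ ⟪ b ⟫
  Moves⇒MapsInto σ mv s v = v , sym (mv s v)

  module _ (σ : Automorphism 𝕄) {C D : SmallSet 𝕄} (into : MapsInto σ C D) where
    open Automorphism σ using (to∘from) renaming (from to σ←)

    renParams : ∀ {x} → x ⊕ Ix C ⟶ x ⊕ Ix D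
    renParams = ⟨ (λ _ → inj₁) , (λ s i → inj₂ (proj₁ (into s i))) ⟩

    tp-pull : ∀ {x} {a b : x ⟶ Carrier} → Moves σ a b →
              ∀ χ → tp a C χ ⇔ tp b D (ren renParams χ)
    tp-pull mv = Sat-transport σ renParams λ where
      s (inj₁ v) → sym (mv s v)
      s (inj₂ i) → proj₂ (into s i)

    Realises-pull : ∀ {x} {a b a′ b′ : x ⟶ Carrier} → Moves σ a b → Moves σ a′ b′ →
                    Realises D b′ (tp b D) → Realises C a′ (tp a C)
    Realises-pull mv mv′ r χ p = from (tp-pull mv′ χ) (r (ren renParams χ) (to (tp-pull mv χ) p))

    -- The inverse automorphism is applied to the dividing sequence: `ψ` has no parameters, and a
    -- type over `D` determines the pulled-back type over `C`.
    Divides-pull : ∀ {x y} (π : FPair x y) {a b : y ⟶ Carrier} → Moves σ a b →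
                   Divides π b D → Divides π a C
    Divides-pull π mv (b′ , real , holds) =
      (λ i s v → σ← s (b′ i s v)) ,
      (λ i → Realises-pull mv (λ s v → to∘from s _) (real i)) ,
      (λ ι inc → from (Sat-conjugate σ (λ s v → sym (to∘from s _)) (ψ π)) (holds ι inc))

  tp-fixed : ∀ σ {C} → Fixes σ C → ∀ {x} {a b : x ⟶ Carrier} → Moves σ a b →
             ∀ χ → tp a C χ ⇔ tp b C χ
  tp-fixed σ fix mv = Sat-conjugate σ λ where
    s (inj₁ v) → sym (mv s v)
    s (inj₂ i) → sym (fix s i)

  Realises-mono : ∀ {C D x} {a b : x ⟶ Carrier} → C ⊆ˢ D →
                  Realises D b (tp a D) → Realises C b (tp a C)
  Realises-mono C⊆D = Realises-pull identity (⊆ˢ⇒MapsInto C⊆D) (λ _ _ → refl) (λ _ _ → refl)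

  Divides-mono : ∀ {C D x y} (π : FPair x y) {b : y ⟶ Carrier} → C ⊆ˢ D →
                 Divides π b D → Divides π b C
  Divides-mono π C⊆D = Divides-pull identity (⊆ˢ⇒MapsInto C⊆D) π (λ _ _ → refl)

  -- Types of tuples are complete: a formula true of `b` but not of `a` would have its negation in
  -- the type of `a`, hence true of `b`.
  Realises-sym : ∀ C {x} {a b : x ⟶ Carrier} →
                 Realises C b (tp a C) → Realises C a (tp b C)
  Realises-sym C r χ p = decidable-stable em λ ¬q →
    Lift.lower (r (¬̇ χ) (λ q → lift (¬q q)) p)

  -- Homogeneity speaks of types over the empty set, so the enumeration of `C` is appended to both
  -- tuples.
  conjugate : ∀ C {x} {a b : x ⟶ Carrier} → Realises C b (tp a C) →
              Σ[ σ ∈ Automorphism 𝕄 ] (Moves σ a b × Fixes σ C)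
  conjugate C {x} {a} {b} r = σ , (λ s v → mv s (inj₁ v)) , (λ s i → mv s (inj₂ i))
    where
    drop∅ : (x ⊕ Ix C) ⊕ ∅ᶜ ⟶ x ⊕ Ix C
    drop∅ s (inj₁ v) = v
    agree : ∀ (c : x ⟶ Carrier) s v →
            ⟨ c , elt C ⟩ s (drop∅ s v) ≡ ⟨ ⟨ c , elt C ⟩ , ⟨⟩ ⟩ s v
    agree c s (inj₁ v) = refl
    conjugation = homogeneous ⟨ a , elt C ⟩ ⟨ b , elt C ⟩ λ χ p →
      to (Sat-ren drop∅ (agree b) χ) (r (ren drop∅ χ) (from (Sat-ren drop∅ (agree a) χ) p))
    σ = proj₁ conjugation
    mv = proj₂ conjugation

  tp-instance : ∀ {C x y} {a : x ⟶ Carrier} {b : y ⟶ Carrier} (β : y ⟶ Ix C) →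
                (∀ s w → elt C s (β s w) ≡ b s w) → ∀ χ →
                tp a C (ren ⟨ (λ _ → inj₁) , (λ s w → inj₂ (β s w)) ⟩ χ) ⇔ _⊨_ 𝕄 χ ⟨ a , b ⟩
  tp-instance β eq = Sat-ren _ λ where
    s (inj₁ v) → refl
    s (inj₂ w) → eq s w

  -- Finite dividing patterns.

  -- The first formula is peeled off and its parameters join the base, so that inductions run from
  -- the front of the pattern. The fixed realisation `a` stands in for the consistency clause.
  data Pattern {x} (Δ : FPairs x) (a : x ⟶ Carrier) (C : SmallSet 𝕄) : ℕ → Set₁ where
    []   : Pattern Δ a C 0
    cons : ∀ {n y} {π : FPair x y} → (y , π) ∈ Δ → (b : y ⟶ Carrier) →
           _⊨_ 𝕄 (φ π) ⟨ a , b ⟩ → Divides π b C →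
           Pattern Δ a (C ∪ˢ ⟪ b ⟫) n → Pattern Δ a C (suc n)

  Pattern-pull : ∀ σ {C D x n} {Δ : FPairs x} {a b : x ⟶ Carrier} →
    MapsInto σ C D → Moves σ a b → Pattern Δ b D n → Pattern Δ a C n
  Pattern-pull σ into mv [] = []
  Pattern-pull σ into mv (cons {π = π} π∈Δ b holds div pat) =
    cons π∈Δ (λ s v → σ← s (b s v))
      (from (Sat-conjugate σ
        (λ { s (inj₁ v) → sym (mv s v) ; s (inj₂ w) → sym (to∘from s _) }) (φ π)) holds)
      (Divides-pull σ into π (λ s w → to∘from s _) div)
      (Pattern-pull σ (MapsInto-∪ σ into (λ s w → w , sym (to∘from s _))) mv pat)
    where open Automorphism σ using (to∘from) renaming (from to σ←)

  Pattern-mono : ∀ {C D x n} {Δ : FPairs x} {a : x ⟶ Carrier} → C ⊆ˢ D →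
                 Pattern Δ a D n → Pattern Δ a C n
  Pattern-mono C⊆D = Pattern-pull identity (⊆ˢ⇒MapsInto C⊆D) (λ _ _ → refl)

  Pattern-realises : ∀ C {x n} {Δ : FPairs x} {a b : x ⟶ Carrier} →
    Realises C b (tp a C) → Pattern Δ b C n → Pattern Δ a C n
  Pattern-realises C r with conjugate C r
  ... | σ , mv , fix = Pattern-pull σ (Fixes⇒MapsInto σ fix) mv

  module _ {x : Ctx} {Δ : FPairs x} {C : SmallSet 𝕄} where

    -- Consistency is witnessed by `a` itself. The type `p` is left open because both the type of
    -- `a` and the empty type are needed.
    Pattern⇒HasPattern : ∀ {n} {a : x ⟶ Carrier} (p : PType x C) → Realises C a p →
      Pattern Δ a C n → HasPattern Δ C p {Fin n} Fin._<_
    Pattern⇒HasPattern {n} {a} p real pat =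
      ξ pat , ∈Δ pat , b pat , consistent , divides pat
      where
      ξ : ∀ {C n} → Pattern Δ a C n → Fin n → Σ[ y ∈ Ctx ] FPair x y
      ξ (cons {π = π} _ _ _ _ pat) Fin.zero    = -, π
      ξ (cons _ _ _ _ pat)         (Fin.suc i) = ξ pat i

      ∈Δ : ∀ {C n} (pat : Pattern Δ a C n) i → ξ pat i ∈ Δ
      ∈Δ (cons π∈Δ _ _ _ pat) Fin.zero    = π∈Δ
      ∈Δ (cons _ _ _ _ pat)   (Fin.suc i) = ∈Δ pat i

      b : ∀ {C n} (pat : Pattern Δ a C n) i → proj₁ (ξ pat i) ⟶ Carrier
      b (cons _ b₀ _ _ pat) Fin.zero    = b₀
      b (cons _ _ _ _ pat)  (Fin.suc i) = b pat i

      holds : ∀ {C n} (pat : Pattern Δ a C n) i →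
              _⊨_ 𝕄 (φ (proj₂ (ξ pat i))) ⟨ a , b pat i ⟩
      holds (cons _ _ h _ pat) Fin.zero    = h
      holds (cons _ _ _ _ pat) (Fin.suc i) = holds pat i

      divides : ∀ {C n} (pat : Pattern Δ a C n) i →
                Divides (proj₂ (ξ pat i)) (b pat i) (below (ξ pat) (b pat) C Fin._<_ i)
      -- No index lies below zero, so only parameters from the base occur here.
      divides {C} (cons {π = π} _ _ _ d pat) Fin.zero =
        Divides-mono π (λ { m (inj₁ c , eq) → c , eq }) d
      divides {C} (cons {π = π} _ _ _ d pat) (Fin.suc i) =
        Divides-mono (proj₂ (ξ pat i))
          (λ { m (inj₁ c , eq) → inj₁ (inj₁ c) , eq
             ; m (inj₂ ((Fin.zero , _) , w) , eq) → inj₁ (inj₂ w) , eq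
             ; m (inj₂ ((Fin.suc j , s≤s j<i) , w) , eq) → inj₂ ((j , j<i) , w) , eq })
          (divides pat i)

      extension : ∀ {χ} → Extend (ξ pat) (b pat) C p χ →
                  tp a (C ∪ˢ ⋃ˢ (Fin n) (λ i → ⟪ b pat i ⟫)) χ
      extension (old {χ} pχ) =
        from (Sat-ren _ (λ { _ (inj₁ _) → refl ; _ (inj₂ _) → refl }) χ) (real χ pχ)
      extension (new i) =
        from (Sat-ren _ (λ { _ (inj₁ _) → refl ; _ (inj₂ _) → refl })
               (φ (proj₂ (ξ pat i)))) (holds pat i)

      consistent : Consistent _ (Extend (ξ pat) (b pat) C p)
      consistent φs ps = a , All.map extension ps

    toPattern : ∀ {a : x ⟶ Carrier} n C (ξ : Fin n → Σ[ y ∈ Ctx ] FPair x y) → (∀ i → ξ i ∈ Δ) →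
      (b : ∀ i → proj₁ (ξ i) ⟶ Carrier) →
      (∀ i → _⊨_ 𝕄 (φ (proj₂ (ξ i))) ⟨ a , b i ⟩) →
      (∀ i → Divides (proj₂ (ξ i)) (b i) (below ξ b C Fin._<_ i)) → Pattern Δ a C n
    toPattern zero    C ξ ∈Δ b holds divides = []
    toPattern (suc n) C ξ ∈Δ b holds divides =
      cons (∈Δ Fin.zero) (b Fin.zero) (holds Fin.zero)
        (Divides-mono (proj₂ (ξ Fin.zero)) (λ m (c , eq) → inj₁ c , eq) (divides Fin.zero))
        (toPattern n (C ∪ˢ ⟪ b Fin.zero ⟫) (ξ ∘ Fin.suc) (∈Δ ∘ Fin.suc) (λ i → b (Fin.suc i))
          (λ i → holds (Fin.suc i))
          λ i → Divides-mono (proj₂ (ξ (Fin.suc i)))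
            (λ { m (inj₁ (inj₁ c) , eq) → inj₁ c , eq
               ; m (inj₁ (inj₂ w) , eq) → inj₂ ((Fin.zero , z<s) , w) , eq
               ; m (inj₂ ((j , j<i) , w) , eq) → inj₂ ((Fin.suc j , s<s j<i) , w) , eq })
            (divides (Fin.suc i)))

    -- Saturation realises the type of `a` together with all formulas of the pattern by some `a′`.
    -- It is conjugate to `a` over `C`, and the pattern is moved back to `a`.
    HasPattern⇒Pattern : ∀ {n} {a : x ⟶ Carrier} →
      HasPattern Δ C (tp a C) {Fin n} Fin._<_ → Pattern Δ a C n
    HasPattern⇒Pattern {n} {a} (ξ , ∈Δ , b , consistent , divides)
      with saturated (Extend ξ b C (tp a C)) consistent
    ... | a′ , real = Pattern-realises C
      (λ χ p → to (Sat-ren _ (λ { _ (inj₁ _) → refl ; _ (inj₂ _) → refl }) χ)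
               (real _ (old {χ = χ} p)))
      (toPattern n C ξ ∈Δ b
        (λ i → to (Sat-ren _ (λ { _ (inj₁ _) → refl ; _ (inj₂ _) → refl }) (φ (proj₂ (ξ i))))
                 (real _ (new i)))
        divides)

  -- Independence in terms of elements.

  module _ (Ω : ΞSubset) where

    -- The relation `⊥⟨ Ω ⟩` freed from the enumerations of its sets: tuples of elements replace
    -- tuples of indices, so sets can be compared by inclusion.
    AvoidsDividing : (A C B : SmallSet 𝕄) → Set₁
    AvoidsDividing A C B = ∀ {x y} (π : FPair x y) (a : x ⟶ Carrier) (b : y ⟶ Carrier) →
      Ω ∋ π → a ∈ᵗ A → b ∈ᵗ (B ∪ˢ C) → _⊨_ 𝕄 (φ π) ⟨ a , b ⟩ → ¬ Divides π b C

    ⊥⇒AvoidsDividing : ∀ A C B → A ⊥⟨ Ω ⟩[ C ] B → AvoidsDividing A C B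
    ⊥⇒AvoidsDividing A C B ind {x} {y} π a b π∈Ω a∈A b∈BC holds div =
      ind (x , (λ s v → proj₁ (a∈A s v)) , y , π , π∈Ω , (λ s w → proj₁ (b∈BC s w)) ,
        from (Sat-ren _ (λ { s (inj₁ v) → proj₂ (a∈A s v) ; s (inj₂ w) → proj₂ (b∈BC s w) })
               (φ π)) holds ,
        Divides-pull identity (⊆ˢ⇒MapsInto {C} {C} (λ _ → id)) π
          (λ s w → proj₂ (b∈BC s w)) div)

    AvoidsDividing⇒⊥ : ∀ A C B → AvoidsDividing A C B → A ⊥⟨ Ω ⟩[ C ] B
    AvoidsDividing⇒⊥ A C B avoids (x , α , y , π , π∈Ω , β , holds , div) =
      avoids π (λ s v → elt A s (α s v)) (λ s w → elt (B ∪ˢ C) s (β s w)) π∈Ω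
        (λ s v → α s v , refl) (λ s w → β s w , refl)
        (to (tp-instance {C = B ∪ˢ C} β (λ _ _ → refl) (φ π)) holds) div

    -- A sequence that shows dividing over `C′` also shows dividing over `C`. So the base may grow
    -- as long as base and right-hand side together stay inside `B ∪ˢ C`.
    AvoidsDividing-mono : ∀ {A C C′ B B′} → C ⊆ˢ C′ → (B′ ∪ˢ C′) ⊆ˢ (B ∪ˢ C) →
      AvoidsDividing A C B → AvoidsDividing A C′ B′
    AvoidsDividing-mono C⊆C′ B′C′⊆BC avoids π a b π∈Ω a∈A b∈B′C′ holds div =
      avoids π a b π∈Ω a∈A (λ s w → B′C′⊆BC _ (b∈B′C′ s w)) holds
        (Divides-mono π C⊆C′ div)

  -- Normality: moving base elements to the right-hand side.

  Divides-substituteˡ : ∀ {x u y C} (f : x ⟶ u) (π : FPair x y) {b : y ⟶ Carrier} →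
    Divides (substitute f (λ _ → id) π) b C ⇔ Divides π b C
  Divides-substituteˡ f π = mk⇔
    (λ (b′ , real , holds) → b′ , real , λ ι inc → to ψ-ren (holds ι inc))
    (λ (b′ , real , holds) → b′ , real , λ ι inc → from ψ-ren (holds ι inc))
    where
    ψ-ren : ∀ {a} → Sat 𝕄 a [] (ren (λ s (i , w) → i , w) (ψ π)) ⇔ Sat 𝕄 a [] (ψ π)
    ψ-ren = Sat-ren _ (λ _ _ → refl) (ψ π)

  φ-substituteˡ : ∀ {x u y} (f : x ⟶ u) (π : FPair x y)
    {a : u ⟶ Carrier} {a′ : x ⟶ Carrier} {b : y ⟶ Carrier} →
    (∀ s v → a s (f s v) ≡ a′ s v) →
    _⊨_ 𝕄 (φ (substitute f (λ _ → id) π)) ⟨ a , b ⟩ ⇔ _⊨_ 𝕄 (φ π) ⟨ a′ , b ⟩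
  φ-substituteˡ f π eq =
    Sat-ren _ (λ { s (inj₁ v) → eq s v ; s (inj₂ w) → refl }) (φ π)

  -- As `c` lies in `C`, keeping it constant along the dividing sequence preserves types over `C`,
  -- and it makes the added equalities trivial.
  Divides-shift : ∀ {x y C} zs (π : FPair (x ⊕ ⌊ zs ⌋) y)
    {c : ⌊ zs ⌋ ⟶ Carrier} {b : y ⟶ Carrier} → c ∈ᵗ C →
    Divides π b C → Divides (shift zs π) ⟨ c , b ⟩ C
  Divides-shift {y = y} {C = C} zs π {c} {b} c∈C (b′ , real , holds) =
    (λ i → ⟨ c , b′ i ⟩) ,
    (λ i χ p → to (absorb-params χ) (real i (ren absorb χ) (from (absorb-params χ) p))) ,
    λ ι inc → from (Sat-ren _ (λ _ _ → refl) (ψ π)) (holds ι inc) ,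
              Sat-⋀ (All.concat⁺ (All.map⁺ (All.universal (constant ι) (consecutive (k π)))))
    where
    -- The variables for `c` are replaced by names of the same elements in `C`.
    absorb : (⌊ zs ⌋ ⊕ y) ⊕ Ix C ⟶ y ⊕ Ix C
    absorb s (inj₁ (inj₁ z)) = inj₂ (proj₁ (c∈C s z))
    absorb s (inj₁ (inj₂ w)) = inj₁ w
    absorb s (inj₂ i)        = inj₂ i

    absorb-params : ∀ {d : y ⟶ Carrier} χ → tp d C (ren absorb χ) ⇔ tp ⟨ c , d ⟩ C χ
    absorb-params χ = Sat-ren absorb
      (λ { s (inj₁ (inj₁ z)) → proj₂ (c∈C s z)
         ; s (inj₁ (inj₂ w)) → refl
         ; s (inj₂ i) → refl }) χ

    constant : ∀ (ι : Fin (k π) → ℕ) ((i , j) : Fin (k π) × Fin (k π)) →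
      All (Sat 𝕄 {x = copies (k π) (⌊ zs ⌋ ⊕ y)} (λ s (l , w) → ⟨ c , b′ (ι l) ⟩ s w) [])
        (mapWith∈ zs λ z → var (i , inj₁ z) ≐ var (j , inj₁ z))
    constant ι (i , j) = mapWith∈⁺ zs λ _ → refl

  infixr 6 _⊕→_

  _⊕→_ : ∀ (u : Ctx) {w w′ : Ctx} → w ⟶ w′ → u ⊕ w ⟶ u ⊕ w′
  (u ⊕→ f) s = Sum.map₂ (f s)

  -- Repetitions are removed, because discarding dummy variables later requires an injective
  -- renaming.
  enumerate : ∀ {w : Ctx} (vs : List (Σ Sort w)) →
    Σ[ zs ∈ List Sort ] Σ[ ε ∈ ⌊ zs ⌋ ⟶ w ] (InjectiveRen ε × All (InImage ε) vs)
  enumerate [] = [] , (λ _ ()) , (λ { _ {()} }) , []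
  enumerate {w} ((s , v) ∷ vs) with enumerate vs
  ... | zs , ε , inj , im with em {P = InImage ε (s , v)}
  ... | yes v∈ε = zs , ε , inj , v∈ε ∷ im
  ... | no v∉ε = s ∷ zs , ε′ , inj′ , (here refl , refl) ∷ All.map (λ (z , eq) → there z , eq) im
    where
    ε′ : ⌊ s ∷ zs ⌋ ⟶ w
    ε′ _ (here refl) = v
    ε′ _ (there z)   = ε _ z
    inj′ : InjectiveRen ε′
    inj′ _ {here refl} {here refl} eq = refl
    inj′ _ {here refl} {there z′}  eq = ⊥-elim (v∉ε (z′ , sym eq))
    inj′ _ {there z}   {here refl} eq = ⊥-elim (v∉ε (z , eq))
    inj′ _ {there z}   {there z′}  eq = cong there (inj _ eq)

  -- Normality moves only finite tuples across, while `w` may be infinite; the variables of `w` that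
  -- occur in `φ` are finitely many.
  finiteʳ : ∀ {u w y : Ctx} (π : FPair (u ⊕ w) y) →
    Σ[ zs ∈ List Sort ] Σ[ ε ∈ ⌊ zs ⌋ ⟶ w ] (InjectiveRen ε ×
      (Σ[ π₀ ∈ FPair (u ⊕ ⌊ zs ⌋) y ]
        substitute (u ⊕→ ε) (λ _ → id) π₀ ≡ π))
  finiteʳ {u} {w} {y} π = zs , ε , inj , pair φ₀ ψ₀ , cong₂ pair φ₀-eq ψ₀-eq
    where
    right : List (Σ Sort ((u ⊕ w) ⊕ y)) → List (Σ Sort w)
    right []                         = []
    right ((_ , inj₁ (inj₁ _)) ∷ vs) = right vs
    right ((s , inj₁ (inj₂ v)) ∷ vs) = (s , v) ∷ right vs
    right ((_ , inj₂ _) ∷ vs)        = right vs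

    enumeration = enumerate (right (free (φ π)))
    zs = proj₁ enumeration
    ε = proj₁ (proj₂ enumeration)
    inj = proj₁ (proj₂ (proj₂ enumeration))

    f : (u ⊕ ⌊ zs ⌋) ⊕ y ⟶ (u ⊕ w) ⊕ y
    f = ⟨ (λ s v → inj₁ ((u ⊕→ ε) s v)) , (λ _ → inj₂) ⟩

    cover : ∀ vs → All (InImage ε) (right vs) → All (InImage f) vs
    cover [] im = []
    cover ((_ , inj₁ (inj₁ v)) ∷ vs) im = (inj₁ (inj₁ v) , refl) ∷ cover vs im
    cover ((_ , inj₁ (inj₂ v)) ∷ vs) ((z , refl) ∷ im) = (inj₁ (inj₂ z) , refl) ∷ cover vs im
    cover ((_ , inj₂ v) ∷ vs) im = (inj₂ v , refl) ∷ cover vs im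

    φ-lift = unren f (φ π) (cover _ (proj₂ (proj₂ (proj₂ enumeration))))
    φ₀ = proj₁ φ-lift
    φ₀-eq = proj₂ φ-lift
    -- The inconsistency witness is renamed by the identity only, but this does not compute away, so
    -- a preimage is taken here as well.
    ψ-lift = unren (λ s (i , w) → i , w) (ψ π) (All.universal (λ (s , v) → v , refl) _)
    ψ₀ = proj₁ ψ-lift
    ψ₀-eq = proj₂ ψ-lift

  module _ {Ω : ΞSubset} (closed : ClosedUnderSubstitution Ω) (normal : Normal Ω) where

    -- If part of the left-hand tuple lies in the base E, normality moves it to
    -- the right-hand side, where it may stay constant along a dividing sequence.
    AvoidsDividing-base : ∀ {A E D} → AvoidsDividing Ω A E D →
                          AvoidsDividing Ω (A ∪ˢ E) E D
    AvoidsDividing-base {A} {E} {D} avoids {x} {y} π a b π∈Ω a∈AE b∈DE holds div =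
      avoids (shift zs π₀) (elt A) ⟨ c , b ⟩ (normal zs π₀ π₀∈Ω) (λ s i → i , refl)
        (λ { s (inj₁ z) → inj₂ (ε s z) , refl ; s (inj₂ w) → b∈DE s w })
        (from (Sat-ren _
           (λ { s (inj₁ (inj₁ i)) → refl ; s (inj₁ (inj₂ z)) → refl ; s (inj₂ w) → refl })
           (φ π₀)) π₀-holds)
        (Divides-shift zs π₀ {c} {b} (λ s z → ε s z , refl) π₀-div)
      where
      f : x ⟶ Ix A ⊕ Ix E
      f s v = proj₁ (a∈AE s v)

      split : FPair (Ix A ⊕ Ix E) y
      split = substitute f (λ _ → id) π

      finite = finiteʳ split
      zs = proj₁ finite
      ε = proj₁ (proj₂ finite)
      π₀ = proj₁ (proj₂ (proj₂ (proj₂ finite)))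
      π₀-eq = proj₂ (proj₂ (proj₂ (proj₂ finite)))

      c : ⌊ zs ⌋ ⟶ Carrier
      c s z = elt E s (ε s z)

      ι : Ix A ⊕ ⌊ zs ⌋ ⟶ Ix A ⊕ Ix E
      ι = Ix A ⊕→ ε

      ι-injective : InjectiveRen ι
      ι-injective s {inj₁ _} {inj₁ _} refl = refl
      ι-injective s {inj₂ _} {inj₂ _} eq =
        cong inj₂ (proj₁ (proj₂ (proj₂ finite)) s (inj₂-injective eq))

      π₀∈Ω : Ω ∋ π₀
      -- Sending entries to indices may identify variables, which closure under substitution
      -- permits. The variables outside the image of the injective `ι` are then dropped as dummies.
      π₀∈Ω = from (ΞSubset.dummies Ω ι (λ _ → id) ι-injective (λ _ → id) π₀)
        (subst (Ω ∋_) (sym π₀-eq) (closed π π∈Ω f (λ _ → id)))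

      π₀-div : Divides π₀ b E
      π₀-div = to (Divides-substituteˡ ι π₀)
        (subst (λ π′ → Divides π′ b E) (sym π₀-eq) (from (Divides-substituteˡ f π) div))

      π₀-holds : _⊨_ 𝕄 (φ π₀) ⟨ ⟨ elt A , c ⟩ , b ⟩
      π₀-holds = to (φ-substituteˡ ι π₀ (λ { s (inj₁ _) → refl ; s (inj₂ _) → refl }))
        (subst (λ π′ → _⊨_ 𝕄 (φ π′) ⟨ ⟨ elt A , elt E ⟩ , b ⟩) (sym π₀-eq)
          (from (φ-substituteˡ f π (λ s v → proj₂ (a∈AE s v))) holds))

  -- Extending the base of dividing formulas and patterns.

  module _ {x y : Ctx} (π : FPair x y) {b : y ⟶ Carrier} {C D : SmallSet 𝕄}
           (C⊆D : C ⊆ˢ D) where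

    private
      sequence : Ctx
      sequence s = ℕ × y s

      entry : ℕ → y ⊕ Ix D ⟶ sequence ⊕ Ix D
      entry i = ⟨ (λ s w → inj₁ (i , w)) , (λ _ → inj₂) ⟩

      params : y ⊕ Ix C ⟶ y ⊕ Ix D
      params = renParams identity {C} {D} (⊆ˢ⇒MapsInto C⊆D)

      -- The new parameters are not prescribed: entry 0 will serve as `b₀`, and `same` makes every
      -- entry realise its type over `D`.
      data DividingSequence : PType sequence D where
        base    : ∀ χ → tp b C χ → DividingSequence (ren (entry 0) (ren params χ))
        same    : ∀ i χ → DividingSequence (ren (entry 0) χ ⇒̇ ren (entry i) χ)
        witness : (ι : Fin (k π) → ℕ) → ι Preserves Fin._<_ ⟶ ℕ._<_ →
                  DividingSequence (ren (λ s (j , w) → inj₁ (ι j , w)) (ψ π))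

      entry-tp : ∀ {d : ℕ → y ⟶ Carrier} i χ →
        tp (λ s (n , w) → d n s w) D (ren (entry i) χ) ⇔ tp (d i) D χ
      entry-tp i = Sat-ren (entry i) λ { s (inj₁ w) → refl ; s (inj₂ j) → refl }

      params-tp : ∀ {d : y ⟶ Carrier} χ → tp d C χ ⇔ tp d D (ren params χ)
      params-tp = tp-pull identity (⊆ˢ⇒MapsInto C⊆D) (λ _ _ → refl)

    -- By the pigeonhole principle some subsequence of a dividing sequence is
    -- constant for the truth of any given finitely many formulas over D.
    Divides-extend : Divides π b C →
      Σ[ b₀ ∈ (y ⟶ Carrier) ] (Realises C b₀ (tp b C) × Divides π b₀ D)
    Divides-extend (b′ , real , holds) =
      (λ s w → d s (0 , w)) ,
      (λ χ p → from (params-tp χ) (to (entry-tp 0 (ren params χ)) (d-real _ (base χ p)))) ,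
      (λ i s w → d s (i , w)) ,
      (λ i χ p → to (entry-tp i χ) (d-real _ (same i χ) (from (entry-tp 0 χ) p))) ,
      (λ ι inc → to (Sat-ren _ (λ _ _ → refl) (ψ π)) (d-real _ (witness ι inc)))
      where
      -- The claim is made for every further thinning `h`, since each formula treated afterwards may
      -- pass to another subsequence.
      settle : ∀ φs → All DividingSequence φs →
        Σ[ g ∈ (ℕ → ℕ) ] (StrictlyIncreasing g × (∀ h → StrictlyIncreasing h →
          All (tp (λ s (i , w) → b′ (g (h i)) s w) D) φs))
      settle [] [] = id , id , λ _ _ → []
      settle (_ ∷ φs) (q ∷ qs) with settle φs qs
      settle (_ ∷ φs) (base χ p ∷ qs) | g , g-inc , all =
        g , g-inc , λ h h-inc →
          from (entry-tp 0 (ren params χ)) (to (params-tp χ) (real (g (h 0)) χ p)) ∷ all h h-inc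
      settle (_ ∷ φs) (same i χ ∷ qs) | g , g-inc , all
        with homogeneous-subsequence (λ n → tp (b′ (g n)) D χ)
      ... | g′ , g′-inc , constant =
        g ∘ g′ , g-inc ∘ g′-inc , λ h h-inc →
          (λ p → from (entry-tp i χ) (constant (h 0) (h i) (to (entry-tp 0 χ) p))) ∷
          all (g′ ∘ h) (g′-inc ∘ h-inc)
      settle (_ ∷ φs) (witness ι inc ∷ qs) | g , g-inc , all =
        g , g-inc , λ h h-inc →
          from (Sat-ren _ (λ _ _ → refl) (ψ π))
            (holds (g ∘ h ∘ ι) (g-inc ∘ h-inc ∘ inc)) ∷ all h h-inc

      realisation = saturated {C = D} DividingSequence λ φs qs →
        -, proj₂ (proj₂ (settle φs qs)) id id
      d = proj₁ realisation
      d-real = proj₂ realisation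

  -- The first parameters `b` are replaced by a conjugate `c` over `C` whose formula divides over
  -- `D`. An automorphism from `c` to `b` pulls the rest of the pattern back over `c`, and the
  -- induction goes on over the bases enlarged by `c`.
  Pattern-extend : ∀ {x n} {Δ : FPairs x} {a : x ⟶ Carrier} C D → C ⊆ˢ D →
    Pattern Δ a C n → Σ[ a′ ∈ (x ⟶ Carrier) ] (Realises C a′ (tp a C) × Pattern Δ a′ D n)
  Pattern-extend {a = a} C D C⊆D [] = a , (λ _ → id) , []
  Pattern-extend {a = a} C D C⊆D (cons {π = π} π∈Δ b holds div pat)
    with Divides-extend π {b} {C} {D} C⊆D div
  ... | c , c-real , c-div with conjugate C (Realises-sym C c-real)
  ... | σ , c↦b , fix
    with Pattern-extend (C ∪ˢ ⟪ c ⟫) (D ∪ˢ ⟪ c ⟫) (∪ˢ-monoˡ ⟪ c ⟫ C⊆D)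
           (Pattern-pull σ (MapsInto-∪ σ (Fixes⇒MapsInto σ fix) (Moves⇒MapsInto σ c↦b))
             (λ s v → Automorphism.to∘from σ s (a s v)) pat)
  ... | a′ , a′-real , pat′ =
    a′ ,
    (λ χ p → Realises-mono {C} {C ∪ˢ ⟪ c ⟫} (⊆-∪ˡ C ⟪ c ⟫) a′-real χ
      (from (tp-fixed σ {C} fix (λ s v → to∘from s (a s v)) χ) p)) ,
    cons π∈Δ c
      -- The preimage of `a` satisfies the formula with parameters `c`, and `a′` has the same type
      -- over `C` and `c`.
      (to (c-instance (φ π)) (a′-real (ren _ (φ π)) (from (c-instance (φ π))
        (from (Sat-conjugate σ (λ { s (inj₁ v) → sym (to∘from s (a s v))
                                  ; s (inj₂ w) → sym (c↦b s w) }) (φ π)) holds))))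
      c-div pat′
    where
    open Automorphism σ using (to∘from)
    c-instance : ∀ {a} χ → tp a (C ∪ˢ ⟪ c ⟫) (ren ⟨ (λ _ → inj₁) , (λ s w → inj₂ (inj₂ w)) ⟩ χ) ⇔
                 _⊨_ 𝕄 χ ⟨ a , c ⟩
    c-instance = tp-instance {C ∪ˢ ⟪ c ⟫} (λ _ → inj₂) (λ _ _ → refl)

  parameters : ∀ {x n C} {Δ : FPairs x} {a : x ⟶ Carrier} → Pattern Δ a C n → SmallSet 𝕄
  parameters []                 = ∅ˢ
  parameters (cons _ b _ _ pat) = ⟪ b ⟫ ∪ˢ parameters pat

  -- Independence and local rank.

  module Independence {Ω : ΞSubset} (closed : ClosedUnderSubstitution Ω)
    (transitive : Transitive Ω) (normal : Normal Ω)
    (finite-rank : ∀ {x : Ctx} (Δ : FPairs x) → Δ ⊆ Ω ↾ → D∅<∞ Δ) where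

    -- Normality adds `E` to the left-hand side, and transitivity then carries dividing over `E` to
    -- dividing over `A ∪ˢ E`. All parameters lie in `D` from the start, so the hypothesis persists
    -- as the base absorbs them one by one.
    Pattern-independent : ∀ A {E D x n} {Δ : FPairs x} {a : x ⟶ Carrier} → Δ ⊆ Ω ↾ →
      (pat : Pattern Δ a E n) → parameters pat ⊆ˢ D → AvoidsDividing Ω A E D →
      Pattern Δ a (A ∪ˢ E) n
    Pattern-independent A Δ⊆Ω [] _ _ = []
    Pattern-independent A {E} {D} Δ⊆Ω (cons {π = π} π∈Δ b holds div pat) params⊆D avoids =
      cons π∈Δ b holds
        (transitive π (All.lookup Δ⊆Ω π∈Δ) E (A ∪ˢ E) b (⊆-∪ʳ A E)
          (AvoidsDividing⇒⊥ Ω (A ∪ˢ E) E ⟪ b ⟫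
            (AvoidsDividing-base {Ω} closed normal {A} {E} {⟪ b ⟫}
              (AvoidsDividing-mono Ω {A} {E} {E} {D} {⟪ b ⟫} (λ _ → id) (∪ˢ-monoˡ E b⊆D) avoids)))
          div)
        (Pattern-mono reassociate
          (Pattern-independent A Δ⊆Ω pat
            (λ m m∈ → params⊆D m (⊆-∪ʳ ⟪ b ⟫ (parameters pat) m m∈))
            (AvoidsDividing-mono Ω {A} {E} {E ∪ˢ ⟪ b ⟫} {D} {D} (⊆-∪ˡ E ⟪ b ⟫)
              (∪ˢ-⊆ {D} {E ∪ˢ ⟪ b ⟫} {D ∪ˢ E} (⊆-∪ˡ D E)
                (∪ˢ-⊆ {E} {⟪ b ⟫} {D ∪ˢ E} (⊆-∪ʳ D E) (λ m m∈b → ⊆-∪ˡ D E m (b⊆D m m∈b))))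
              avoids)))
      where
      b⊆D : ⟪ b ⟫ ⊆ˢ D
      b⊆D m m∈b = params⊆D m (⊆-∪ˡ ⟪ b ⟫ (parameters pat) m m∈b)
      reassociate : ((A ∪ˢ E) ∪ˢ ⟪ b ⟫) ⊆ˢ (A ∪ˢ (E ∪ˢ ⟪ b ⟫))
      reassociate m (inj₁ (inj₁ i) , eq) = inj₁ i , eq
      reassociate m (inj₁ (inj₂ i) , eq) = inj₂ (inj₁ i) , eq
      reassociate m (inj₂ i , eq)        = inj₂ (inj₂ i) , eq

    module _ {x : Ctx} (Δ : FPairs x) (Δ⊆Ω : Δ ⊆ Ω ↾) (a : x ⟶ Carrier) where

      -- The right-hand side is enlarged by the parameters of the given pattern. The automorphism
      -- taking `B` to the independent copy `B′` fixes `a` and `C`, so the pattern over `B′` pulls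
      -- back to one over `B`.
      ⊥*⇒Pattern-∪ : ∀ {n} B C → B ⊥*⟨ Ω ⟩[ C ] ⟪ a ⟫ → Pattern Δ a C n → Pattern Δ a (B ∪ˢ C) n
      ⊥*⇒Pattern-∪ B C ind pat
        with ind (⟪ a ⟫ ∪ˢ parameters pat) (⊆-∪ˡ ⟪ a ⟫ (parameters pat))
      ... | B′ , (σ , fix , B→B′ , _) , B′-ind =
        Pattern-pull σ {B ∪ˢ C} {B′ ∪ˢ C}
          (MapsInto-∪ σ {B} {C} {B′} {C} (λ s i → B→B′ _ (i , refl))
            (λ s i → i , sym (fix _ (inj₂ i , refl))))
          (λ s v → fix _ (inj₁ v , refl))
          (Pattern-independent B′ Δ⊆Ω pat (⊆-∪ʳ ⟪ a ⟫ (parameters pat))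
            (⊥⇒AvoidsDividing Ω B′ C _ B′-ind))

      -- Over the empty base the pattern is one for the empty type, whose rank is a bound
      -- independent of `C`.
      Pattern-bounded : ∀ C m → Pattern Δ a C m → m ℕ.≤ proj₁ (finite-rank Δ Δ⊆Ω)
      Pattern-bounded C m pat = proj₂ (proj₂ (proj₂ (finite-rank Δ Δ⊆Ω))) m
        (Pattern⇒HasPattern (∅ᵗ ∅ˢ) (λ _ ()) (Pattern-mono {∅ˢ} {C} (λ { _ (() , _) }) pat))

      D-fin : ∀ {n} C → Pattern Δ a C n → (∀ m → Pattern Δ a C m → m ℕ.≤ n) →
              D Δ ⟨ C , tp a C ⟩≔ fin n
      D-fin {n} C pat max =
        -- Patterns of all order types would include one of length `suc n`.
        (λ all → ℕ.<-irrefl refl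
          (max (suc n) (HasPattern⇒Pattern (all Fin._<_ Fin.<-isStrictTotalOrder)))) ,
        Pattern⇒HasPattern (tp a C) (λ _ → id) pat ,
        λ m hp → max m (HasPattern⇒Pattern hp)

      ⊥*⇒SameD : ∀ B C → B ⊥*⟨ Ω ⟩[ C ] ⟪ a ⟫ → SameD Δ a (B ∪ˢ C) C
      ⊥*⇒SameD B C ind with maximum (Pattern Δ a C) _ [] (Pattern-bounded C)
      ... | n , pat , max = fin n ,
        D-fin (B ∪ˢ C) (⊥*⇒Pattern-∪ B C ind pat)
          (λ m pat′ → max m (Pattern-mono (⊆-∪ʳ B C) pat′)) ,
        D-fin C pat max

      SameD⇒Pattern : ∀ B C → SameD Δ a B C →
        Σ[ n ∈ ℕ ] (Pattern Δ a B n × ¬ Pattern Δ a C (suc n))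
      SameD⇒Pattern B C (fin n , (_ , hp , _) , (_ , _ , max)) =
        n , HasPattern⇒Pattern hp , λ pat →
          ℕ.<-irrefl refl (max (suc n) (Pattern⇒HasPattern (tp a C) (λ _ → id) pat))
      -- The omitted length is one more than the rank of the empty type.
      SameD⇒Pattern B C (∞ , all , _) = ⊥-elim (ℕ.<-irrefl refl
        (Pattern-bounded B _ (HasPattern⇒Pattern (all Fin._<_ Fin.<-isStrictTotalOrder))))

    module _ {x : Ctx} (a : x ⟶ Carrier) (B C B̂ : SmallSet 𝕄) (B⊆B̂ : B ⊆ˢ B̂) where

      private
        BC⊆B̂C : (B ∪ˢ C) ⊆ˢ (B̂ ∪ˢ C)
        BC⊆B̂C = ∪ˢ-monoˡ C B⊆B̂

        -- Its realisations are the conjugates of `a` over `B ∪ˢ C` that are independent from `B̂`.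
        -- Subtuples of `x` are covered by closure under substitution.
        data NonDividingExtension : PType x (B̂ ∪ˢ C) where
          extends : ∀ χ → tp a (B ∪ˢ C) χ →
            NonDividingExtension (ren (renParams identity {D = B̂ ∪ˢ C} (⊆ˢ⇒MapsInto BC⊆B̂C)) χ)
          avoids : ∀ {y} (π : FPair x y) → Ω ∋ π → (β : y ⟶ Ix (B̂ ∪ˢ C)) →
            Divides π (λ s w → elt (B̂ ∪ˢ C) s (β s w)) C →
            NonDividingExtension (¬̇ ren ⟨ (λ _ → inj₁) , (λ s w → inj₂ (β s w)) ⟩ (φ π))

        extends-tp : ∀ {a′ : x ⟶ Carrier} χ → tp a′ (B ∪ˢ C) χ ⇔
          tp a′ (B̂ ∪ˢ C) (ren (renParams identity {D = B̂ ∪ˢ C} (⊆ˢ⇒MapsInto BC⊆B̂C)) χ)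
        extends-tp = tp-pull identity {B ∪ˢ C} {B̂ ∪ˢ C} (⊆ˢ⇒MapsInto BC⊆B̂C) (λ _ _ → refl)

        -- The finite `Δ` to which equality of ranks is applied.
        avoided : ∀ {φs} → All NonDividingExtension φs → FPairs x
        avoided []                    = []
        avoided (extends _ _ ∷ ps)    = avoided ps
        avoided (avoids π _ _ _ ∷ ps) = (-, π) ∷ avoided ps

        avoided⊆Ω : ∀ {φs} (ps : All NonDividingExtension φs) → avoided ps ⊆ Ω ↾
        avoided⊆Ω []                      = []
        avoided⊆Ω (extends _ _ ∷ ps)      = avoided⊆Ω ps
        avoided⊆Ω (avoids _ π∈Ω _ _ ∷ ps) = π∈Ω ∷ avoided⊆Ω ps

      SameD⇒consistent : (∀ (Δ : FPairs x) → Δ ⊆ Ω ↾ → SameD Δ a (B ∪ˢ C) C) →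
                         Consistent (B̂ ∪ˢ C) NonDividingExtension
      SameD⇒consistent same φs ps
        with SameD⇒Pattern (avoided ps) (avoided⊆Ω ps) a (B ∪ˢ C) C
               (same (avoided ps) (avoided⊆Ω ps))
      ... | n , pat , ¬longer with Pattern-extend (B ∪ˢ C) (B̂ ∪ˢ C) BC⊆B̂C pat
      ... | a′ , real , pat′ = a′ , satisfies ps id
        where
        satisfies : ∀ {χs} (qs : All NonDividingExtension χs) →
          (∀ {e} → e ∈ avoided qs → e ∈ avoided ps) → All (tp a′ (B̂ ∪ˢ C)) χs
        satisfies [] _ = []
        satisfies (extends χ p ∷ qs) inc = to (extends-tp χ) (real χ p) ∷ satisfies qs inc
        satisfies (avoids π _ β div ∷ qs) inc =
          -- The forbidden formula is put in front of `pat′`, whose base `B̂ ∪ˢ C` contains its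
          -- parameters. The resulting pattern over `C` has length `suc n` and moves from `a′` to
          -- `a`.
          (λ holds → ⊥-elim (¬longer (Pattern-realises C
            (Realises-mono {C} {B ∪ˢ C} (⊆-∪ʳ B C) real)
            (cons (inc (here refl)) _
              (to (tp-instance {B̂ ∪ˢ C} β (λ _ _ → refl) (φ π)) holds) div
              (Pattern-mono (∪ˢ-⊆ {C} {⟪ (λ s w → elt (B̂ ∪ˢ C) s (β s w)) ⟫} {B̂ ∪ˢ C}
                (⊆-∪ʳ B̂ C) (λ { m (w , eq) → β _ w , eq })) pat′))))) ∷
          satisfies qs (λ e∈ → inc (there e∈))

      consistent⇒independent : Consistent (B̂ ∪ˢ C) NonDividingExtension →
        ∃[ A′ ] (⟪ a ⟫ ≡[ B ∪ˢ C ] A′ × A′ ⊥⟨ Ω ⟩[ C ] B̂)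
      consistent⇒independent consistent with saturated NonDividingExtension consistent
      ... | a′ , real with conjugate (B ∪ˢ C) (λ χ p → from (extends-tp χ) (real _ (extends χ p)))
      ... | σ , a↦a′ , fix = ⟪ a′ ⟫ ,
        (σ , (λ { m (i , refl) → fix _ i })
           , (λ { m (v , refl) → v , sym (a↦a′ _ v) })
           , (λ { m (v , refl) → a _ v , (v , refl) , a↦a′ _ v })) ,
        -- A tuple picked from `a′` by `α`, possibly with repetitions, is turned into the full tuple
        -- by substitution.
        λ (x₁ , α , y , π , π∈Ω , β , holds , div) →
          Lift.lower (real _
            (avoids (substitute α (λ _ → id) π) (closed π π∈Ω α (λ _ → id)) β
              (from (Divides-substituteˡ α π) div))
            (from (tp-instance {B̂ ∪ˢ C} β (λ _ _ → refl) (φ (substitute α (λ _ → id) π)))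
              (from (φ-substituteˡ α π (λ _ _ → refl))
                (to (tp-instance {B̂ ∪ˢ C} β (λ _ _ → refl) (φ π)) holds))))

    module _ {x : Ctx} (a : x ⟶ Carrier) (B C : SmallSet 𝕄) where

      SameD⇒⊥* : (∀ (Δ : FPairs x) → Δ ⊆ Ω ↾ → SameD Δ a (B ∪ˢ C) C) → ⟪ a ⟫ ⊥*⟨ Ω ⟩[ C ] B
      SameD⇒⊥* same B̂ B⊆B̂ =
        consistent⇒independent a B C B̂ B⊆B̂ (SameD⇒consistent a B C B̂ B⊆B̂ same)

    ⊥*-sym : ∀ A B C → A ⊥*⟨ Ω ⟩[ C ] B → B ⊥*⟨ Ω ⟩[ C ] A
    ⊥*-sym A B C ind = SameD⇒⊥* (elt B) A C λ Δ Δ⊆Ω → ⊥*⇒SameD Δ Δ⊆Ω (elt B) A C ind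

theorem2p27 :
  (∀ {ℓ} → ExcludedMiddle ℓ) →
  (L : Language) →
  let open FirstOrder L in
  (T : Theory) →
  CompleteTheory T → ConsistentTheory T →
  (𝔐 : BigModel T) →
  let open BigModel 𝔐
      open Small 𝕄
      open Dividing 𝔐 in
  (Ω : ΞSubset) →
  ClosedUnderSubstitution Ω → Transitive Ω → Normal Ω →
  (∀ {x : Ctx} (Δ : FPairs x) → Δ ⊆ Ω ↾ → D∅<∞ Δ) →
  ∀ {x : Ctx} (a : x ⟶ Carrier) (B C : SmallSet 𝕄) →
  ((⟪ a ⟫ ⊥*⟨ Ω ⟩[ C ] B)
    ⇔ (∀ (Δ : FPairs x) → Δ ⊆ Ω ↾ → SameD Δ a (B ∪ˢ C) C))
  × ((∀ (Δ : FPairs x) → Δ ⊆ Ω ↾ → SameD Δ a (B ∪ˢ C) C)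
    ⇔ (B ⊥*⟨ Ω ⟩[ C ] ⟪ a ⟫))
theorem2p27 em L T _ _ 𝔐 Ω closed transitive normal finite-rank a B C =
    -- Symmetry turns (1) into (3), from which (2) follows.
    mk⇔ (λ ind Δ Δ⊆Ω → ⊥*⇒SameD Δ Δ⊆Ω a B C (⊥*-sym ⟪ a ⟫ B C ind)) (SameD⇒⊥* a B C)
  , mk⇔ (λ same → ⊥*-sym ⟪ a ⟫ B C (SameD⇒⊥* a B C same))
      (λ ind Δ Δ⊆Ω → ⊥*⇒SameD Δ Δ⊆Ω a B C ind)
  where
  open FirstOrder L using (⟪_⟫)
  open InBigModel em L 𝔐
  open Independence {Ω} closed transitive normal finite-rank
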